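{- Let $\mathcal{H}=(\mathcal{U},\mathcal{N})$ be a hypergraph with net set $\mathcal{N}=\{n_i\}$, let $\mathcal{G}=(\mathcal{V},\mathcal{E})$ be its net intersection graph, whose vertex $v_i$ corresponds to the net $n_i$, and let $K\ge 2$. Let $\{\mathcal{V}_1,\ldots,\mathcal{V}_K;\mathcal{V}_S\}$ be a $K$-way vertex partition of $\mathcal{G}$ by a narrow vertex separator $\mathcal{V}_S$. Put $\mathcal{N}_k=\{n_i\in\mathcal{N}: v_i\in\mathcal{V}_k\}$ for $1\le k\le K$ and $\mathcal{N}_S=\{n_i\in\mathcal{N}: v_i\in\mathcal{V}_S\}$. Then $\{\mathcal{N}_1,\ldots,\mathcal{N}_K;\mathcal{N}_S\}$ is a $K$-way contention-free net partition of $\mathcal{H}$ by the net separator $\mathcal{N}_S$.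
   Context: All graphs and hypergraphs are finite. A hypergraph $\mathcal{H}=(\mathcal{U},\mathcal{N})$ consists of a set $\mathcal{U}$ of nodes and a set $\mathcal{N}$ of nets; each net $n_i$ connects a nonempty set of nodes $Pins(n_i)\subseteq\mathcal{U}$. Distinct nets may have the same pin set. For $\mathcal{N}'\subseteq\mathcal{N}$, $Pins(\mathcal{N}')=\bigcup_{n_i\in\mathcal{N}'}Pins(n_i)$. The net intersection graph (NIG) of $\mathcal{H}$ is the simple undirected graph $\mathcal{G}=(\mathcal{V},\mathcal{E})$ with one vertex $v_i$ for each net $n_i$, in which distinct vertices $v_i,v_j$ are adjacent if and only if $Pins(n_i)\cap Pins(n_j)\neq\emptyset$. For a vertex subset $\mathcal{V}'$, $Adj(\mathcal{V}')$ is the set of vertices outside $\mathcal{V}'$ adjacent to some vertex of $\mathcal{V}'$. A set $\mathcal{V}_S\subset\mathcal{V}$ is a $K$-way vertex separator if the subgraph induced by $\mathcal{V}-\mathcal{V}_S$ has at least $K$ connected components. A $K$-way vertex partition $\{\mathcal{V}_1,\ldots,\mathcal{V}_K;\mathcal{V}_S\}$ of $\mathcal{G}$ by vertex separator $\mathcal{V}_S$ means: each $\mathcal{V}_k$ is nonempty; $\mathcal{V}_1,\ldots,\mathcal{V}_K,\mathcal{V}_S$ are pairwise disjoint with union $\mathcal{V}$; and $Adj(\mathcal{V}_k)\cap\mathcal{V}_\ell=\emptyset$ for $k\ne\ell$. A $K$-way vertex separator is narrow if no proper subset of it is a $K$-way vertex separator. A set $\mathcal{N}_S\subset\mathcal{N}$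 is a ($K$-way) net separator if its removal disconnects the hypergraph into at least $K$ connected components, i.e. $(\mathcal{U},\mathcal{N}-\mathcal{N}_S)$ has at least $K$ connected components (two nodes being in the same component if they are linked by a chain of nets of $\mathcal{N}-\mathcal{N}_S$, consecutive ones sharing pins). A net partition $\{\mathcal{N}_1,\ldots,\mathcal{N}_K;\mathcal{N}_S\}$ (pairwise disjoint sets with union $\mathcal{N}$, with $\mathcal{N}_1,\ldots,\mathcal{N}_K$ nonempty) is contention-free if $Pins(\mathcal{N}_k)\cap Pins(\mathcal{N}_\ell)=\emptyset$ for all $1\le k<\ell\le K$, i.e. no two nets belonging to two different parts share a pin. -}

module Defs where

open import Level using (0ℓ)
open import Data.Nat using (ℕ)
open import Data.Fin using (Fin; _<_; _≟_)
open import Data.Fin.Subset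
  using (Subset; _∈_; _∉_; _∩_; _⊂_; ∁; Nonempty; Empty)
open import Data.Fin.Subset.Properties using (nonempty?; ∩-comm)
open import Data.Product using (Σ; ∃; _×_; _,_; proj₁; map)
open import Data.Sum using (_⊎_)
open import Function.Base using (_on_)
open import Function.Bundles using (Injection)
open import Relation.Binary.Bundles using (Setoid)
open import Relation.Binary.Core using (Rel)
open import Relation.Binary.Definitions using (Decidable; Symmetric; Irreflexive)
import Relation.Binary.Construct.Closure.Equivalence as EqClosure
open import Relation.Binary.PropositionalEquality
  using (_≡_; _≢_; sym; subst)
import Relation.Binary.PropositionalEquality.Properties as ≡
open import Relation.Nullary using (¬_)
open import Relation.Nullary.Decidable using (_×-dec_; ¬?)
open import Relation.Unary using (Pred; _⊥_)

record Hypergraph : Set where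
  field
    #nodes        : ℕ
    #nets         : ℕ
    pins          : Fin #nets → Subset #nodes
    pins-nonempty : ∀ i → Nonempty (pins i)

  Node Net : Set
  Node = Fin #nodes
  Net  = Fin #nets

  Pins : Subset #nets → Pred Node 0ℓ
  Pins W u = ∃ λ i → i ∈ W × u ∈ pins i

record Graph (n : ℕ) : Set₁ where
  field
    Adjacent    : Rel (Fin n) 0ℓ
    adjacent?   : Decidable Adjacent
    symmetric   : Symmetric Adjacent
    irreflexive : Irreflexive _≡_ Adjacent

  Adj : Subset n → Pred (Fin n) 0ℓ
  Adj W v = v ∉ W × ∃ λ w → w ∈ W × Adjacent w v

-- The vertex vᵢ of the net nᵢ has the same index i, so a set of vertices of
-- nig H and the corresponding set of nets of H are the same Subset.
nig : (H : Hypergraph) → Graph (Hypergraph.#nets H)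
nig H = record
  { Adjacent    = λ i j → i ≢ j × Nonempty (pins i ∩ pins j)
  ; adjacent?   = λ i j → ¬? (i ≟ j) ×-dec nonempty? (pins i ∩ pins j)
  ; symmetric   = λ {i} {j} → map (λ i≢j j≡i → i≢j (sym j≡i))
                                  (subst Nonempty (∩-comm (pins i) (pins j)))
  ; irreflexive = λ { i≡j (i≢j , _) → i≢j i≡j }
  }
  where open Hypergraph H

-- The elements of X up to the equivalence generated by _∼_; as a quotient,
-- this setoid is the set of connected components.
Components : {X : Set} → Rel X 0ℓ → Setoid 0ℓ 0ℓ
Components _∼_ = EqClosure.setoid _∼_

AtLeast : ℕ → Setoid 0ℓ 0ℓ → Set
AtLeast K C = Injection (≡.setoid (Fin K)) C

IsVertexSeparator : ∀ {n} → Graph n → ℕ → Subset n → Set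
IsVertexSeparator {n} G K S =
  AtLeast K (Components {X = Σ (Fin n) (_∈ ∁ S)} (Graph.Adjacent G on proj₁))

IsNarrowVertexSeparator : ∀ {n} → Graph n → ℕ → Subset n → Set
IsNarrowVertexSeparator G K S =
  IsVertexSeparator G K S × (∀ T → T ⊂ S → ¬ IsVertexSeparator G K T)

-- A chain u₀ ∼ u₁ ∼ … ∼ uₘ for this relation is a chain of nets outside S in
-- which the (a-1)-th and a-th nets share the pin uₐ₋₁. A node that is a pin of
-- no remaining net is a component by itself.
IsNetSeparator : (H : Hypergraph) → ℕ → Subset (Hypergraph.#nets H) → Set
IsNetSeparator H K S = AtLeast K (Components {X = Node} Linked)
  where
  open Hypergraph H
  Linked : Rel Node 0ℓ
  Linked u v = ∃ λ i → i ∈ ∁ S × u ∈ pins i × v ∈ pins i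

record IsPartition {n K : ℕ} (part : Fin K → Subset n) (S : Subset n) : Set where
  field
    nonempty      : ∀ k → Nonempty (part k)
    disjoint      : ∀ k ℓ → k ≢ ℓ → Empty (part k ∩ part ℓ)
    disjoint-from : ∀ k → Empty (part k ∩ S)
    covers        : ∀ i → (∃ λ k → i ∈ part k) ⊎ i ∈ S

record IsVertexPartition {n K : ℕ} (G : Graph n)
                         (part : Fin K → Subset n) (S : Subset n) : Set where
  field
    isPartition : IsPartition part S
    separated   : ∀ k ℓ → k ≢ ℓ → Graph.Adj G (part k) ⊥ (_∈ part ℓ)

record IsContentionFreeNetPartition {K : ℕ} (H : Hypergraph)
         (part : Fin K → Subset (Hypergraph.#nets H))
         (S : Subset (Hypergraph.#nets H)) : Set where
  open Hypergraph H using (Pins)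
  field
    isPartition    : IsPartition part S
    contentionFree : ∀ k ℓ → k < ℓ → Pins (part k) ⊥ Pins (part ℓ)

{-# OPTIONS --safe #-}
-- Nets of different parts share no pin, so the pin sets of the parts are
-- pairwise disjoint. A net outside the separator belongs to some part, so a
-- chain of such nets never leaves the pin set of a part; hence one pin chosen
-- for each part gives K nodes in distinct components.
module Submission where

open import Defs
open import Data.Nat using (ℕ; _≤_)
open import Data.Fin using (Fin; _≟_)
open import Data.Fin.Properties using (<⇒≢)
open import Data.Fin.Subset using (Subset; _∈_; ∁)
open import Data.Fin.Subset.Properties using (x∈p∩q⁺; x∈∁p⇒x∉p)
open import Data.Product using (_×_; _,_; ∃; proj₁; proj₂)
open import Data.Sum using (inj₁; inj₂)
open import Function.Bundles using (mk⇔; Equivalence)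
open import Function.Properties.Equivalence using (⇔-isEquivalence)
import Relation.Binary.Construct.Closure.Equivalence as EqClosure
open import Relation.Binary.PropositionalEquality using (_≡_; _≢_; refl)
open import Relation.Nullary using (contradiction)
open import Relation.Nullary.Decidable using (decidable-stable)
open import Relation.Unary using (_⊥_)

module _ (H : Hypergraph) {K : ℕ} {V : Fin K → Subset (Hypergraph.#nets H)}
         {S : Subset (Hypergraph.#nets H)} where
  open Hypergraph H

  -- A pin `u` common to a net `i` of `V k` and a net `j` of `V ℓ` makes `i` and `j` adjacent in
  -- `nig H`, since disjointness of the parts gives `i ≢ j`. Then `j` lies in both `Adj (V k)` and
  -- `V ℓ`.
  separated⇒contentionFree : IsVertexPartition (nig H) V S →
    ∀ {k ℓ} → k ≢ ℓ → Pins (V k) ⊥ Pins (V ℓ)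
  separated⇒contentionFree vp {k} {ℓ} k≢ℓ {u} ((i , i∈Vk , u∈i) , (j , j∈Vℓ , u∈j)) =
    separated k ℓ k≢ℓ ((j∉Vk , i , i∈Vk , i≢j , u , x∈p∩q⁺ (u∈i , u∈j)) , j∈Vℓ)
    where
    open IsVertexPartition vp
    open IsPartition isPartition
    j∉Vk = λ j∈Vk → disjoint k ℓ k≢ℓ (j , x∈p∩q⁺ (j∈Vk , j∈Vℓ))
    i≢j : i ≢ j
    i≢j refl = j∉Vk i∈Vk

  contentionFree⇒netSeparator : IsPartition V S →
    (∀ {k ℓ} → k ≢ ℓ → Pins (V k) ⊥ Pins (V ℓ)) → IsNetSeparator H K S
  contentionFree⇒netSeparator p free = record
    { to        = λ k → proj₁ (pin k)
    ; cong      = λ { refl → EqClosure.reflexive _ }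
    ; injective = λ {k} {ℓ} k∼ℓ → samePart
        (Equivalence.to
          -- Being a pin of part `k` is an invariant of the component: each link preserves it in
          -- both directions, so it folds along the closure to an equivalence between the chosen
          -- pins of `k` and `ℓ`.
          (EqClosure.gfold ⇔-isEquivalence (Pins (V k))
            (λ (i , i∈∁S , u∈i , v∈i) → mk⇔ (stay i∈∁S u∈i v∈i) (stay i∈∁S v∈i u∈i))
            k∼ℓ)
          (proj₂ (pin k)))
        (proj₂ (pin ℓ))
    }
    where
    open IsPartition p

    pin : ∀ k → ∃ (Pins (V k))
    pin k = let i , i∈Vk = nonempty k ; u , u∈i = pins-nonempty i in u , i , i∈Vk , u∈i

    samePart : ∀ {k ℓ u} → Pins (V k) u → Pins (V ℓ) u → k ≡ ℓ
    samePart {k} {ℓ} uk uℓ = decidable-stable (k ≟ ℓ) λ k≢ℓ → free k≢ℓ (uk , uℓ)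

    stay : ∀ {k i u v} → i ∈ ∁ S → u ∈ pins i → v ∈ pins i →
           Pins (V k) u → Pins (V k) v
    stay {i = i} i∈∁S u∈i v∈i uk with covers i
    ... | inj₂ i∈S = contradiction i∈S (x∈∁p⇒x∉p i∈∁S)
    -- The node `u` is a pin of part `k` by assumption and of part `ℓ` through `i`, which forces `ℓ`
    -- to be `k`.
    ... | inj₁ (ℓ , i∈Vℓ) with refl ← samePart uk (i , i∈Vℓ , u∈i) = i , i∈Vℓ , v∈i

theorem1 : (H : Hypergraph) (K : ℕ) → 2 ≤ K →
    (V : Fin K → Subset (Hypergraph.#nets H)) (V-S : Subset (Hypergraph.#nets H)) →
    IsVertexPartition (nig H) V V-S →
    IsNarrowVertexSeparator (nig H) K V-S →
    IsContentionFreeNetPartition H V V-S × IsNetSeparator H K V-S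
theorem1 H K _ V V-S vp _ =
  record { isPartition    = isPartition
         ; contentionFree = λ _ _ k<ℓ → free (<⇒≢ k<ℓ) } ,
  contentionFree⇒netSeparator H isPartition free
  where
  open IsVertexPartition vp using (isPartition)
  free = λ {k} {ℓ} → separated⇒contentionFree H vp {k} {ℓ}
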